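{- Let $\mathbb H=(A,\prec,\mathcal C)$ be an sp-algebra and $\mathbb K=(A,\prec,\mathcal D)$ an sdp-algebra. Write $\overline{\mathcal C}$, $\overline{\mathcal D}$ for the complements of $\mathcal C,\mathcal D$ in $A\times A$. In $A^\delta$ let $\Diamond a=\bigwedge\{b\mid a\prec b\}$, $\blacksquare a=\bigvee\{b\mid b\prec a\}$, $\rhd a=\bigvee\{b\mid a\,\overline{\mathcal C}\,b\}$, $\blacktriangleright a=\bigvee\{b\mid b\,\overline{\mathcal C}\,a\}$, $\lhd a=\bigwedge\{b\mid a\,\overline{\mathcal D}\,b\}$ (with $a,b$ in $A$), $\Diamond$ and $\rhd$ being extended to $A^\delta$ as $\Diamond^\sigma$ and $\rhd^\pi$ (superscripts omitted). Inequalities are in $A^\delta$ with $a,b,c$ ranging over $A$. 1. $\mathbb H$ satisfies (INC) iff $\blacksquare a\le\blacktriangleright a$ for all $a$. 2. If $A$ is a meet-semilattice, then $\mathbb H$ satisfies (CT)$^\rhd$ iff $\rhd(a\wedge\Diamond a)\le\rhd a$ for all $a$. 3. If $A$ (for $\mathbb H$) is a Heyting algebra, then (i) $\mathbb H$ satisfies (CS2) iff $\Diamond a\to\rhd a\le\rhd a$ for all $a$; (ii) $\mathbb H$ satisfies (CT)$^\downarrow$ iff $\blacksquare b\wedge\blacktriangleright(b\wedge c)\le b\to\blacktriangleright c$ for all $b,c$. 4. If $A$ (for $\mathbb H$) is a co-Heyting algebra, then $\mathbb H$ satisfies (CS1) iff $\Diamond a\le\Diamond a\setminus\rhd a$ for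 all $a$. 5. If $A$ (for $\mathbb K$) is a co-Heyting algebra, then $\mathbb K$ satisfies (CT)$^\lhd$ iff $\lhd a\le\Diamond(\lhd a\setminus a)$ for all $a$.
   Context: Canonical extension. For a poset $A$, $A^\delta$ is a complete lattice containing $A$ as a subposet. $k\in A^\delta$ is closed ($k\in K(A^\delta)$) if $k=\bigwedge F$ for some nonempty down-directed $F\subseteq A$; $o$ is open ($o\in O(A^\delta)$) if $o=\bigvee I$ for some nonempty up-directed $I\subseteq A$. Denseness: every element of $A^\delta$ is a join of closed elements and a meet of open elements. Compactness: if $F\subseteq A$ is nonempty down-directed, $I\subseteq A$ nonempty up-directed and $\bigwedge F\le\bigvee I$, then $a\le b$ for some $a\in F$, $b\in I$. $A^\delta$ exists and is unique up to isomorphism fixing $A$. Throughout $A$ is a bounded lattice. $(A,\prec)$ is a subordination algebra if $\bot\prec\bot$; $\top\prec\top$; $a\le b\prec x\Rightarrow a\prec x$; $b\prec x\le y\Rightarrow b\prec y$; $a\prec x\ \&\ a\prec y\Rightarrow a\prec x\wedge y$; $a\prec x\ \&\ b\prec x\Rightarrow a\vee b\prec x$. $(A,\mathcal C)$ is a precontact algebra if $\bot\,\overline{\mathcal C}\,\top$; $\top\,\overline{\mathcal C}\,\bot$; $b\,\overline{\mathcal C}\,c\ \&\ a\le b\Rightarrow a\,\overline{\mathcal C}\,c$; $a\,\overline{\mathcal C}\,c\ \&\ b\le c\Rightarrow a\,\overline{\mathcal C}\,b$; $a\,\overline{\mathcal C}\,b\ \&\ a\,\overline{\mathcal C}\,c\Rightarrow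 a\,\overline{\mathcal C}\,(b\vee c)$; $a\,\overline{\mathcal C}\,c\ \&\ b\,\overline{\mathcal C}\,c\Rightarrow(a\vee b)\,\overline{\mathcal C}\,c$. $(A,\mathcal D)$ is a dual precontact algebra if $\top\,\overline{\mathcal D}\,\bot$; $\bot\,\overline{\mathcal D}\,\top$; $a\le b\ \&\ a\,\overline{\mathcal D}\,c\Rightarrow b\,\overline{\mathcal D}\,c$; $a\,\overline{\mathcal D}\,c\ \&\ c\le b\Rightarrow a\,\overline{\mathcal D}\,b$; $a\,\overline{\mathcal D}\,b\ \&\ a\,\overline{\mathcal D}\,c\Rightarrow a\,\overline{\mathcal D}\,(b\wedge c)$; $a\,\overline{\mathcal D}\,c\ \&\ b\,\overline{\mathcal D}\,c\Rightarrow(a\wedge b)\,\overline{\mathcal D}\,c$. An sp-algebra is $(A,\prec,\mathcal C)$ with $(A,\prec)$ a subordination algebra and $(A,\mathcal C)$ a precontact algebra; an sdp-algebra is $(A,\prec,\mathcal D)$ with $(A,\prec)$ a subordination algebra and $(A,\mathcal D)$ a dual precontact algebra. Extensions: $\Diamond^\sigma k=\bigwedge\{\Diamond a\mid a\in A,k\le a\}$ for $k$ closed, $\Diamond^\sigma u=\bigvee\{\Diamond^\sigma k\mid k\in K(A^\delta),k\le u\}$; $\rhd^\pi k=\bigvee\{\rhd a\mid a\in A,k\le a\}$ for $k$ closed, $\rhd^\pi u=\bigwedge\{\rhd^\pi k\mid k\in K(A^\delta),k\le u\}$. A co-Heyting algebra is a (bounded) distributive lattice with a binary operation $\setminus$ such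 that $a\setminus b\le c$ iff $a\le c\vee b$. In $A^\delta$: in the Heyting case $u\to v$ is the largest $w$ with $u\wedge w\le v$; in the co-Heyting case $u\setminus v$ is the least $w$ with $u\le w\vee v$. Conditions (free variables universally quantified): (INC) $a\prec b\Rightarrow a\,\overline{\mathcal C}\,b$. (CT)$^\rhd$ $a\prec b\ \&\ (a\wedge b)\,\overline{\mathcal C}\,c\Rightarrow a\,\overline{\mathcal C}\,c$. (CS1) $a\prec x\vee y\ \&\ a\,\overline{\mathcal C}\,x\Rightarrow a\prec y$. (CS2) $a\,\overline{\mathcal C}\,(x\wedge y)\ \&\ a\prec x\Rightarrow a\,\overline{\mathcal C}\,y$. (CT)$^\downarrow$ $a\prec b\ \&\ a\,\overline{\mathcal C}\,(b\wedge c)\Rightarrow(a\wedge b)\,\overline{\mathcal C}\,c$. (CT)$^\lhd$ $a\,\overline{\mathcal D}\,b\ \&\ (b\setminus a)\prec c\Rightarrow a\,\overline{\mathcal D}\,c$. -}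

module Defs where

open import Algebra.Core using (Op₂)
open import Data.Product using (Σ-syntax; ∃-syntax; _×_; _,_; proj₁; proj₂)
open import Data.Sum using (_⊎_; inj₁; inj₂)
open import Level using (Level; suc; _⊔_)
open import Relation.Binary.Bundles using (Poset)
open import Relation.Binary.Core using (Rel)
open import Relation.Binary.Lattice
open import Relation.Binary.Morphism.Structures using (IsOrderMonomorphism)
open import Relation.Nullary using (¬_)
open import Relation.Unary using (Pred; _∈_; _⊆_; Satisfiable)

private
  variable
    p : Level

module Subsets {c ℓ₁ ℓ₂} (P : Poset c ℓ₁ ℓ₂) where
  open Poset P

  IsLub : Pred Carrier p → Carrier → Set _
  IsLub S u = (∀ x → x ∈ S → x ≤ u) × (∀ v → (∀ x → x ∈ S → x ≤ v) → u ≤ v)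

  IsGlb : Pred Carrier p → Carrier → Set _
  IsGlb S u = (∀ x → x ∈ S → u ≤ x) × (∀ v → (∀ x → x ∈ S → v ≤ x) → v ≤ u)

  UpDirected : Pred Carrier p → Set _
  UpDirected S = ∀ x y → x ∈ S → y ∈ S → ∃[ z ] z ∈ S × x ≤ z × y ≤ z

  DownDirected : Pred Carrier p → Set _
  DownDirected S = ∀ x y → x ∈ S → y ∈ S → ∃[ z ] z ∈ S × z ≤ x × z ≤ y

-- Subsets live at the same universe level as the carrier.
record CompleteLattice ℓ : Set (suc ℓ) where
  field
    poset : Poset ℓ ℓ ℓ
  open Poset poset
  open Subsets poset
  field
    ⋁     : Pred Carrier ℓ → Carrier
    ⋀     : Pred Carrier ℓ → Carrier
    ⋁-lub : ∀ S → IsLub S (⋁ S)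
    ⋀-glb : ∀ S → IsGlb S (⋀ S)

  ⋁-upper : ∀ S {x} → x ∈ S → x ≤ ⋁ S
  ⋁-upper S = proj₁ (⋁-lub S) _

  ⋁-least : ∀ S {v} → (∀ x → x ∈ S → x ≤ v) → ⋁ S ≤ v
  ⋁-least S = proj₂ (⋁-lub S) _

  ⋀-lower : ∀ S {x} → x ∈ S → ⋀ S ≤ x
  ⋀-lower S = proj₁ (⋀-glb S) _

  ⋀-greatest : ∀ S {v} → (∀ x → x ∈ S → v ≤ x) → v ≤ ⋀ S
  ⋀-greatest S = proj₂ (⋀-glb S) _

  ｛_،_｝ : Carrier → Carrier → Pred Carrier ℓ
  ｛ u ، v ｝ x = x ≈ u ⊎ x ≈ v

  lattice : Lattice ℓ ℓ ℓ
  lattice = record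
    { Carrier = Carrier
    ; _≈_ = _≈_
    ; _≤_ = _≤_
    ; _∨_ = λ u v → ⋁ ｛ u ، v ｝
    ; _∧_ = λ u v → ⋀ ｛ u ، v ｝
    ; isLattice = record
      { isPartialOrder = isPartialOrder
      ; supremum = λ u v →
          ⋁-upper ｛ u ، v ｝ (inj₁ Eq.refl)
        , ⋁-upper ｛ u ، v ｝ (inj₂ Eq.refl)
        , λ w u≤w v≤w → ⋁-least ｛ u ، v ｝ λ where
            x (inj₁ x≈u) → trans (reflexive x≈u) u≤w
            x (inj₂ x≈v) → trans (reflexive x≈v) v≤w
      ; infimum = λ u v →
          ⋀-lower ｛ u ، v ｝ (inj₁ Eq.refl)
        , ⋀-lower ｛ u ، v ｝ (inj₂ Eq.refl)
        , λ w w≤u w≤v → ⋀-greatest ｛ u ، v ｝ λ where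
            x (inj₁ x≈u) → trans w≤u (reflexive (Eq.sym x≈u))
            x (inj₂ x≈v) → trans w≤v (reflexive (Eq.sym x≈v))
      }
    }

module LatticeWithSubsets {ℓ} (A : BoundedLattice ℓ ℓ ℓ) where
  open BoundedLattice A public
  open Subsets (Lattice.poset lattice) public

-- Being closed or open quantifies over subsets of A, so it is a predicate one
-- universe above A.  The complete lattice is placed there in order that the
-- joins and meets of families of closed or open elements exist.
record CanonicalExtension {ℓ} (A : BoundedLattice ℓ ℓ ℓ) : Set (suc (suc ℓ)) where
  private
    module A = LatticeWithSubsets A

  field
    completeLattice : CompleteLattice (suc ℓ)

  open CompleteLattice completeLattice public
    using (⋁; ⋀; ⋁-upper; ⋁-least; ⋀-lower; ⋀-greatest; lattice)
  open Lattice lattice public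
    renaming ( Carrier to Carrierδ; _≈_ to infix 4 _≈δ_; _≤_ to infix 4 _≤δ_
             ; _∨_ to infixr 6 _∨δ_; _∧_ to infixr 7 _∧δ_ )

  field
    e           : A.Carrier → Carrierδ
    e-embedding : IsOrderMonomorphism A._≈_ _≈δ_ A._≤_ _≤δ_ e

  e⟨_⟩ : Pred A.Carrier ℓ → Pred Carrierδ (suc ℓ)
  e⟨ S ⟩ u = ∃[ a ] a ∈ S × u ≈δ e a

  IsClosed : Pred Carrierδ (suc ℓ)
  IsClosed k = Σ[ F ∈ Pred A.Carrier ℓ ]
    Satisfiable F × A.DownDirected F × k ≈δ ⋀ e⟨ F ⟩

  IsOpen : Pred Carrierδ (suc ℓ)
  IsOpen o = Σ[ I ∈ Pred A.Carrier ℓ ]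
    Satisfiable I × A.UpDirected I × o ≈δ ⋁ e⟨ I ⟩

  field
    dense-closed : ∀ u → Σ[ S ∈ Pred Carrierδ (suc ℓ) ] S ⊆ IsClosed × u ≈δ ⋁ S
    dense-open   : ∀ u → Σ[ S ∈ Pred Carrierδ (suc ℓ) ] S ⊆ IsOpen × u ≈δ ⋀ S
    compact      : ∀ (F I : Pred A.Carrier ℓ) →
                   Satisfiable F → A.DownDirected F →
                   Satisfiable I → A.UpDirected I →
                   ⋀ e⟨ F ⟩ ≤δ ⋁ e⟨ I ⟩ →
                   ∃[ a ] ∃[ b ] a ∈ F × b ∈ I × a A.≤ b

  infixr 5 _⇒δ_
  infixl 6 _∖δ_

  -- For distributive A these are the largest w with u ∧ w ≤ v and the least w
  -- with u ≤ w ∨ v: see ⇒δ-largest and ∖δ-least.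
  _⇒δ_ : Op₂ Carrierδ
  u ⇒δ v = ⋁ (λ w → u ∧δ w ≤δ v)

  _∖δ_ : Op₂ Carrierδ
  u ∖δ v = ⋀ (λ w → u ≤δ w ∨δ v)

  σᴷ : (A.Carrier → Carrierδ) → Carrierδ → Carrierδ
  σᴷ f k = ⋀ (λ v → ∃[ a ] k ≤δ e a × v ≈δ f a)

  πᴷ : (A.Carrier → Carrierδ) → Carrierδ → Carrierδ
  πᴷ f k = ⋁ (λ v → ∃[ a ] k ≤δ e a × v ≈δ f a)

  -- The σ-extension of an order preserving map and the π-extension of an order
  -- reversing one.  On closed elements they coincide with σᴷ and πᴷ: see
  -- σ-closed and π-closed.
  _^σ : (A.Carrier → Carrierδ) → Carrierδ → Carrierδ
  (f ^σ) u = ⋁ (λ v → ∃[ k ] IsClosed k × k ≤δ u × v ≈δ σᴷ f k)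

  _^π : (A.Carrier → Carrierδ) → Carrierδ → Carrierδ
  (f ^π) u = ⋀ (λ v → ∃[ k ] IsClosed k × k ≤δ u × v ≈δ πᴷ f k)

  σ-closed : ∀ f {k} → IsClosed k → (f ^σ) k ≈δ σᴷ f k
  σ-closed f {k} kc = antisym
    (⋁-least _ λ v (k′ , _ , k′≤k , v≈) → trans (reflexive v≈)
      (⋀-greatest _ λ w (a , k≤a , w≈) → ⋀-lower _ (a , trans k′≤k k≤a , w≈)))
    (⋁-upper _ (k , kc , refl , Eq.refl))

  π-closed : ∀ f {k} → IsClosed k → (f ^π) k ≈δ πᴷ f k
  π-closed f {k} kc = antisym
    (⋀-lower _ (k , kc , refl , Eq.refl))
    (⋀-greatest _ λ v (k′ , _ , k′≤k , v≈) → trans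
      (⋁-least _ λ w (a , k≤a , w≈) → ⋁-upper _ (a , trans k′≤k k≤a , w≈))
      (reflexive (Eq.sym v≈)))

  private
    mono : ∀ {a b} → a A.≤ b → e a ≤δ e b
    mono = IsOrderMonomorphism.mono e-embedding

    closed≤ : ∀ {u v} → (∀ {k} → IsClosed k → k ≤δ u → k ≤δ v) → u ≤δ v
    closed≤ {u} h with dense-closed u
    ... | S , S⊆K , u≈ = trans (reflexive u≈) (⋁-least S λ k k∈S →
          h (S⊆K k∈S) (trans (⋁-upper S k∈S) (reflexive (Eq.sym u≈))))

    open≥ : ∀ {u v} → (∀ {o} → IsOpen o → v ≤δ o → u ≤δ o) → u ≤δ v
    open≥ {v = v} h with dense-open v
    ... | S , S⊆O , v≈ = trans (⋀-greatest S λ o o∈S →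
          h (S⊆O o∈S) (trans (reflexive v≈) (⋀-lower S o∈S))) (reflexive (Eq.sym v≈))

    below : ∀ {F k a} → k ≈δ ⋀ e⟨ F ⟩ → a ∈ F → k ≤δ e a
    below k≈ a∈F = trans (reflexive k≈) (⋀-lower _ (_ , a∈F , Eq.refl))

    above : ∀ {I o a} → o ≈δ ⋁ e⟨ I ⟩ → a ∈ I → e a ≤δ o
    above o≈ a∈I = trans (⋁-upper _ (_ , a∈I , Eq.refl)) (reflexive (Eq.sym o≈))

  module _ (distributive : IsDistributiveLattice A._≈_ A._≤_ A._∨_ A._∧_) where
    open IsDistributiveLattice distributive using (∧-distribˡ-∨)
    open import Relation.Binary.Lattice.Properties.MeetSemilattice
      (Lattice.meetSemilattice A.lattice) using () renaming (∧-monotonic to A-∧-mono)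
    open import Relation.Binary.Lattice.Properties.JoinSemilattice
      (Lattice.joinSemilattice A.lattice) using () renaming (∨-monotonic to A-∨-mono)

    private
      distributiveLattice : DistributiveLattice ℓ ℓ ℓ
      distributiveLattice = record { isDistributiveLattice = distributive }

    open import Relation.Binary.Lattice.Properties.DistributiveLattice
      distributiveLattice using (∨-distribˡ-∧)

    ⇒δ-largest : ∀ u v → u ∧δ (u ⇒δ v) ≤δ v × (∀ w → u ∧δ w ≤δ v → w ≤δ u ⇒δ v)
    ⇒δ-largest u v = closed≤ (λ kc k≤ → open≥ (k≤o kc k≤)) , λ w h → ⋁-upper _ h
      where
      k≤o : ∀ {k} → IsClosed k → k ≤δ u ∧δ (u ⇒δ v) → ∀ {o} → IsOpen o → v ≤δ o → k ≤δ o
      k≤o {k} (F , (f₀ , f₀∈) , Fd , k≈) k≤ {o} (I , (i₀ , i₀∈) , Iu , o≈) v≤o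
        with compact F J (f₀ , f₀∈) Fd (i₀ , f₀ , i₀ , f₀∈ , i₀∈ , A.x∧y≤y _ _) Ju
               (trans (reflexive (Eq.sym k≈)) (trans (trans k≤ (x∧y≤y _ _)) (⋁-least _ w≤J)))
        where
        J : Pred A.Carrier ℓ
        J b = ∃[ f ] ∃[ i ] f ∈ F × i ∈ I × f A.∧ b A.≤ i

        Ju : A.UpDirected J
        Ju b b′ (f , i , f∈ , i∈ , q) (f′ , i′ , f′∈ , i′∈ , q′)
          with Fd f f′ f∈ f′∈ | Iu i i′ i∈ i′∈
        ... | f″ , f″∈ , f″≤f , f″≤f′ | i″ , i″∈ , i≤i″ , i′≤i″ =
          b A.∨ b′
          , ( f″ , i″ , f″∈ , i″∈
            , A.trans (A.reflexive (∧-distribˡ-∨ _ _ _))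
                (A.∨-least
                  (A.trans (A-∧-mono f″≤f A.refl) (A.trans q i≤i″))
                  (A.trans (A-∧-mono f″≤f′ A.refl) (A.trans q′ i′≤i″))))
          , A.x≤x∨y _ _ , A.y≤x∨y _ _

        w≤J : ∀ w → u ∧δ w ≤δ v → w ≤δ ⋁ e⟨ J ⟩
        w≤J w u∧w≤v = closed≤ λ { {x} (G , (g₀ , g₀∈) , Gd , x≈) x≤w →
          let
            H : Pred A.Carrier ℓ
            H c = ∃[ f ] ∃[ g ] f ∈ F × g ∈ G × c A.≈ f A.∧ g

            Hd : A.DownDirected H
            Hd = λ { c c′ (f , g , f∈ , g∈ , c≈) (f′ , g′ , f′∈ , g′∈ , c′≈) →
              let f″ , f″∈ , f″≤f , f″≤f′ = Fd f f′ f∈ f′∈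
                  g″ , g″∈ , g″≤g , g″≤g′ = Gd g g′ g∈ g′∈
              in f″ A.∧ g″ , (f″ , g″ , f″∈ , g″∈ , A.Eq.refl)
                 , A.trans (A-∧-mono f″≤f g″≤g) (A.reflexive (A.Eq.sym c≈))
                 , A.trans (A-∧-mono f″≤f′ g″≤g′) (A.reflexive (A.Eq.sym c′≈)) }

            H≤k : ⋀ e⟨ H ⟩ ≤δ k
            H≤k = trans
              (⋀-greatest e⟨ F ⟩ λ _ (f , f∈ , y≈) → trans
                (⋀-lower e⟨ H ⟩ (_ , (f , g₀ , f∈ , g₀∈ , A.Eq.refl) , Eq.refl))
                (trans (mono (A.x∧y≤x _ _)) (reflexive (Eq.sym y≈))))
              (reflexive (Eq.sym k≈))

            H≤x : ⋀ e⟨ H ⟩ ≤δ x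
            H≤x = trans
              (⋀-greatest e⟨ G ⟩ λ _ (g , g∈ , y≈) → trans
                (⋀-lower e⟨ H ⟩ (_ , (f₀ , g , f₀∈ , g∈ , A.Eq.refl) , Eq.refl))
                (trans (mono (A.x∧y≤y _ _)) (reflexive (Eq.sym y≈))))
              (reflexive (Eq.sym x≈))

            c , i , (f , g , f∈ , g∈ , c≈) , i∈ , c≤i =
              compact H I (_ , f₀ , g₀ , f₀∈ , g₀∈ , A.Eq.refl) Hd (i₀ , i₀∈) Iu
                (trans (∧-greatest (trans H≤k (trans k≤ (x∧y≤x _ _))) (trans H≤x x≤w))
                  (trans u∧w≤v (trans v≤o (reflexive o≈))))
          in trans (below x≈ g∈)
               (⋁-upper _ (g , (f , i , f∈ , i∈ , A.trans (A.reflexive (A.Eq.sym c≈)) c≤i)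
                          , Eq.refl)) }
      ... | f , b , f∈ , (f′ , i , f′∈ , i∈ , f′∧b≤i) , f≤b with Fd f f′ f∈ f′∈
      ... | f″ , f″∈ , f″≤f , f″≤f′ =
        trans (below k≈ f″∈)
          (trans (mono (A.trans (A.∧-greatest f″≤f′ (A.trans f″≤f f≤b)) f′∧b≤i))
            (above o≈ i∈))

    ∖δ-least : ∀ u v → u ≤δ (u ∖δ v) ∨δ v × (∀ w → u ≤δ w ∨δ v → u ∖δ v ≤δ w)
    ∖δ-least u v = open≥ (λ oo ≤o → closed≤ (λ kc k≤u → k≤o oo ≤o kc k≤u)) , λ w h → ⋀-lower _ h
      where
      k≤o : ∀ {o} → IsOpen o → (u ∖δ v) ∨δ v ≤δ o → ∀ {k} → IsClosed k → k ≤δ u → k ≤δ o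
      k≤o {o} (I , (i₀ , i₀∈) , Iu , o≈) ≤o {k} (F , (f₀ , f₀∈) , Fd , k≈) k≤u
        with compact J I (f₀ , f₀ , i₀ , f₀∈ , i₀∈ , A.y≤x∨y _ _) Jd (i₀ , i₀∈) Iu
               (trans (⋀-greatest _ J≤w) (trans (trans (x≤x∨y _ _) ≤o) (reflexive o≈)))
        where
        J : Pred A.Carrier ℓ
        J b = ∃[ f ] ∃[ i ] f ∈ F × i ∈ I × f A.≤ i A.∨ b

        Jd : A.DownDirected J
        Jd b b′ (f , i , f∈ , i∈ , q) (f′ , i′ , f′∈ , i′∈ , q′)
          with Fd f f′ f∈ f′∈ | Iu i i′ i∈ i′∈
        ... | f″ , f″∈ , f″≤f , f″≤f′ | i″ , i″∈ , i≤i″ , i′≤i″ =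
          b A.∧ b′
          , ( f″ , i″ , f″∈ , i″∈
            , A.trans
                (A.∧-greatest
                  (A.trans (A.trans f″≤f q) (A-∨-mono i≤i″ A.refl))
                  (A.trans (A.trans f″≤f′ q′) (A-∨-mono i′≤i″ A.refl)))
                (A.reflexive (A.Eq.sym (∨-distribˡ-∧ _ _ _))))
          , A.x∧y≤x _ _ , A.x∧y≤y _ _

        J≤w : ∀ w → u ≤δ w ∨δ v → ⋀ e⟨ J ⟩ ≤δ w
        J≤w w u≤w∨v = open≥ λ { {x} (G , (g₀ , g₀∈) , Gu , x≈) w≤x →
          let
            H : Pred A.Carrier ℓ
            H c = ∃[ i ] ∃[ g ] i ∈ I × g ∈ G × c A.≈ i A.∨ g

            Hu : A.UpDirected H
            Hu = λ { c c′ (i , g , i∈ , g∈ , c≈) (i′ , g′ , i′∈ , g′∈ , c′≈) →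
              let i″ , i″∈ , i≤i″ , i′≤i″ = Iu i i′ i∈ i′∈
                  g″ , g″∈ , g≤g″ , g′≤g″ = Gu g g′ g∈ g′∈
              in i″ A.∨ g″ , (i″ , g″ , i″∈ , g″∈ , A.Eq.refl)
                 , A.trans (A.reflexive c≈) (A-∨-mono i≤i″ g≤g″)
                 , A.trans (A.reflexive c′≈) (A-∨-mono i′≤i″ g′≤g″) }

            o≤H : o ≤δ ⋁ e⟨ H ⟩
            o≤H = trans (reflexive o≈)
              (⋁-least e⟨ I ⟩ λ _ (i , i∈ , y≈) → trans
                (trans (reflexive y≈) (mono (A.x≤x∨y _ _)))
                (⋁-upper e⟨ H ⟩ (_ , (i , g₀ , i∈ , g₀∈ , A.Eq.refl) , Eq.refl)))

            x≤H : x ≤δ ⋁ e⟨ H ⟩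
            x≤H = trans (reflexive x≈)
              (⋁-least e⟨ G ⟩ λ _ (g , g∈ , y≈) → trans
                (trans (reflexive y≈) (mono (A.y≤x∨y _ _)))
                (⋁-upper e⟨ H ⟩ (_ , (i₀ , g , i₀∈ , g∈ , A.Eq.refl) , Eq.refl)))

            f , c , f∈ , (i , g , i∈ , g∈ , c≈) , f≤c =
              compact F H (f₀ , f₀∈) Fd (_ , i₀ , g₀ , i₀∈ , g₀∈ , A.Eq.refl) Hu
                (trans (trans (reflexive (Eq.sym k≈)) (trans k≤u u≤w∨v))
                  (∨-least (trans w≤x x≤H) (trans (trans (y≤x∨y _ _) ≤o) o≤H)))
          in trans
               (⋀-lower _ (g , (f , i , f∈ , i∈ , A.trans f≤c (A.reflexive c≈)) , Eq.refl))
               (above x≈ g∈) }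
      ... | b , i , (f , i′ , f∈ , i′∈ , f≤i′∨b) , i∈ , b≤i with Iu i i′ i∈ i′∈
      ... | i″ , i″∈ , i≤i″ , i′≤i″ =
        trans (below k≈ f∈)
          (trans (mono (A.trans f≤i′∨b (A.∨-least i′≤i″ (A.trans b≤i i≤i″))))
            (above o≈ i″∈))

-- The contact relations are C and D themselves; their complements, which the
-- axioms are about, are written with ¬.
module Structures {ℓ} (A : BoundedLattice ℓ ℓ ℓ) where
  open BoundedLattice A

  record IsSubordinationAlgebra (_≺_ : Rel Carrier ℓ) : Set ℓ where
    field
      ⊥≺⊥   : ⊥ ≺ ⊥
      ⊤≺⊤   : ⊤ ≺ ⊤
      ≤-≺   : ∀ {a b x} → a ≤ b → b ≺ x → a ≺ x
      ≺-≤   : ∀ {b x y} → b ≺ x → x ≤ y → b ≺ y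
      ≺-∧   : ∀ {a x y} → a ≺ x → a ≺ y → a ≺ (x ∧ y)
      ∨-≺   : ∀ {a b x} → a ≺ x → b ≺ x → (a ∨ b) ≺ x

  record IsPrecontactAlgebra (_C_ : Rel Carrier ℓ) : Set ℓ where
    field
      ⊥C̸⊤ : ¬ (⊥ C ⊤)
      ⊤C̸⊥ : ¬ (⊤ C ⊥)
      ≤-C̸ : ∀ {a b c} → ¬ (b C c) → a ≤ b → ¬ (a C c)
      C̸-≤ : ∀ {a b c} → ¬ (a C c) → b ≤ c → ¬ (a C b)
      C̸-∨ : ∀ {a b c} → ¬ (a C b) → ¬ (a C c) → ¬ (a C (b ∨ c))
      ∨-C̸ : ∀ {a b c} → ¬ (a C c) → ¬ (b C c) → ¬ ((a ∨ b) C c)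

  record IsDualPrecontactAlgebra (_D_ : Rel Carrier ℓ) : Set ℓ where
    field
      ⊤D̸⊥ : ¬ (⊤ D ⊥)
      ⊥D̸⊤ : ¬ (⊥ D ⊤)
      ≤-D̸ : ∀ {a b c} → a ≤ b → ¬ (a D c) → ¬ (b D c)
      D̸-≤ : ∀ {a b c} → ¬ (a D c) → c ≤ b → ¬ (a D b)
      D̸-∧ : ∀ {a b c} → ¬ (a D b) → ¬ (a D c) → ¬ (a D (b ∧ c))
      ∧-D̸ : ∀ {a b c} → ¬ (a D c) → ¬ (b D c) → ¬ ((a ∧ b) D c)

  record IsSpAlgebra (_≺_ _C_ : Rel Carrier ℓ) : Set ℓ where
    field
      isSubordinationAlgebra : IsSubordinationAlgebra _≺_
      isPrecontactAlgebra    : IsPrecontactAlgebra _C_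

  record IsSdpAlgebra (_≺_ _D_ : Rel Carrier ℓ) : Set ℓ where
    field
      isSubordinationAlgebra  : IsSubordinationAlgebra _≺_
      isDualPrecontactAlgebra : IsDualPrecontactAlgebra _D_

  IsHeyting : Op₂ Carrier → Set ℓ
  IsHeyting _⇨_ = IsHeytingAlgebra _≈_ _≤_ _∨_ _∧_ _⇨_ ⊤ ⊥

  record IsCoHeyting (_∖_ : Op₂ Carrier) : Set ℓ where
    field
      isDistributiveLattice : IsDistributiveLattice _≈_ _≤_ _∨_ _∧_
      residual              : ∀ a b c → ((a ∖ b) ≤ c → a ≤ c ∨ b) × (a ≤ c ∨ b → (a ∖ b) ≤ c)

  INC : (_≺_ _C_ : Rel Carrier ℓ) → Set ℓ
  INC _≺_ _C_ = ∀ a b → a ≺ b → ¬ (a C b)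

  CT▷ : (_≺_ _C_ : Rel Carrier ℓ) → Set ℓ
  CT▷ _≺_ _C_ = ∀ a b c → a ≺ b → ¬ ((a ∧ b) C c) → ¬ (a C c)

  CS1 : (_≺_ _C_ : Rel Carrier ℓ) → Set ℓ
  CS1 _≺_ _C_ = ∀ a x y → a ≺ (x ∨ y) → ¬ (a C x) → a ≺ y

  CS2 : (_≺_ _C_ : Rel Carrier ℓ) → Set ℓ
  CS2 _≺_ _C_ = ∀ a x y → ¬ (a C (x ∧ y)) → a ≺ x → ¬ (a C y)

  CT↓ : (_≺_ _C_ : Rel Carrier ℓ) → Set ℓ
  CT↓ _≺_ _C_ = ∀ a b c → a ≺ b → ¬ (a C (b ∧ c)) → ¬ ((a ∧ b) C c)

  CT◁ : (_∖_ : Op₂ Carrier) (_≺_ _D_ : Rel Carrier ℓ) → Set ℓ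
  CT◁ _∖_ _≺_ _D_ = ∀ a b c → ¬ (a D b) → (b ∖ a) ≺ c → ¬ (a D c)

module Operators {ℓ} (A : BoundedLattice ℓ ℓ ℓ) (Aδ : CanonicalExtension A)
                 (_≺_ _C_ _D_ : Rel (BoundedLattice.Carrier A) ℓ) where
  open BoundedLattice A using (Carrier)
  open CanonicalExtension Aδ

  ◇ ■ ▷ ▶ ◁ : Carrier → Carrierδ
  ◇ a = ⋀ e⟨ (λ b → a ≺ b) ⟩
  ■ a = ⋁ e⟨ (λ b → b ≺ a) ⟩
  ▷ a = ⋁ e⟨ (λ b → ¬ (a C b)) ⟩
  ▶ a = ⋁ e⟨ (λ b → ¬ (b C a)) ⟩
  ◁ a = ⋀ e⟨ (λ b → ¬ (a D b)) ⟩

{-# OPTIONS --safe #-}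

-- Every operator here is a meet of a filter base of A or a join of an ideal
-- base of A, so compactness turns an inequality "meet ≤ join" into an
-- inequality between elements of A, which is what the conditions speak about.
-- Denseness reduces the inequalities that are not of this shape (those
-- involving the residuals ⇒δ and ∖δ) to ones that are.

module Submission where

open import Defs
open import Data.Product using (_×_; _,_; proj₁; proj₂; ∃-syntax)
open import Function.Bundles using (_⇔_; mk⇔)
open import Relation.Binary.Core using (Rel)
open import Relation.Binary.Lattice
open import Relation.Binary.Morphism.Structures using (IsOrderMonomorphism)
open import Relation.Nullary using (¬_)
open import Relation.Unary using (Pred; _∈_; Satisfiable)

-- Denseness and compactness in terms of directed subsets of `A`.

module CanonicalExtensionProperties {ℓ} {A : BoundedLattice ℓ ℓ ℓ}
                                    (Aδ : CanonicalExtension A) where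
  private
    module A = LatticeWithSubsets A
  open import Relation.Binary.Lattice.Properties.MeetSemilattice
    (Lattice.meetSemilattice A.lattice) using () renaming (∧-monotonic to A-∧-mono)
  open import Relation.Binary.Lattice.Properties.JoinSemilattice
    (Lattice.joinSemilattice A.lattice) using () renaming (∨-monotonic to A-∨-mono)
  open CanonicalExtension Aδ
  open import Relation.Binary.Lattice.Properties.MeetSemilattice
    (Lattice.meetSemilattice lattice) using (∧-monotonic)
  open import Relation.Binary.Lattice.Properties.JoinSemilattice
    (Lattice.joinSemilattice lattice) using (∨-monotonic)

  IsFilterBase IsIdealBase : Pred A.Carrier ℓ → Set ℓ
  IsFilterBase F = Satisfiable F × A.DownDirected F
  IsIdealBase I = Satisfiable I × A.UpDirected I

  private
    variable
      F G I J : Pred A.Carrier ℓ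
      a b     : A.Carrier
      u v     : Carrierδ

  e-mono : a A.≤ b → e a ≤δ e b
  e-mono = IsOrderMonomorphism.mono e-embedding

  ⋀e≤ : a ∈ F → ⋀ e⟨ F ⟩ ≤δ e a
  ⋀e≤ a∈F = ⋀-lower _ (_ , a∈F , Eq.refl)

  ≤⋁e : a ∈ I → e a ≤δ ⋁ e⟨ I ⟩
  ≤⋁e a∈I = ⋁-upper _ (_ , a∈I , Eq.refl)

  ≤⋀e : (∀ {a} → a ∈ F → u ≤δ e a) → u ≤δ ⋀ e⟨ F ⟩
  ≤⋀e h = ⋀-greatest _ λ _ (_ , a∈F , x≈) → trans (h a∈F) (reflexive (Eq.sym x≈))

  ⋁e≤ : (∀ {a} → a ∈ I → e a ≤δ u) → ⋁ e⟨ I ⟩ ≤δ u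
  ⋁e≤ h = ⋁-least _ λ _ (_ , a∈I , x≈) → trans (reflexive x≈) (h a∈I)

  -- By denseness `u` is a join of closed elements, so an inequality may be tested on the closed
  -- elements below `u`. They are given by their bases, ready for compactness.
  closed≤ : (∀ {F} → IsFilterBase F → ⋀ e⟨ F ⟩ ≤δ u → ⋀ e⟨ F ⟩ ≤δ v) → u ≤δ v
  closed≤ {u} h with dense-closed u
  ... | S , S⊆K , u≈ = trans (reflexive u≈) (⋁-least S λ k k∈S →
    let F , s , d , k≈ = S⊆K k∈S
        k≤u = trans (⋁-upper S k∈S) (reflexive (Eq.sym u≈))
    in trans (reflexive k≈) (h (s , d) (trans (reflexive (Eq.sym k≈)) k≤u)))

  open≥ : (∀ {I} → IsIdealBase I → v ≤δ ⋁ e⟨ I ⟩ → u ≤δ ⋁ e⟨ I ⟩) → u ≤δ v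
  open≥ {v} h with dense-open v
  ... | S , S⊆O , v≈ = trans (⋀-greatest S λ o o∈S →
    let I , s , d , o≈ = S⊆O o∈S
        v≤o = trans (reflexive v≈) (⋀-lower S o∈S)
    in trans (h (s , d) (trans v≤o (reflexive o≈))) (reflexive (Eq.sym o≈)))
    (reflexive (Eq.sym v≈))

  -- Principal filters and ideals exhibit each `e a` as both closed and open, so that compactness
  -- also applies to single elements of `A`.
  ↑ ↓ : A.Carrier → Pred A.Carrier ℓ
  ↑ a x = a A.≤ x
  ↓ a x = x A.≤ a

  ↑-filterBase : IsFilterBase (↑ a)
  ↑-filterBase = (_ , A.refl) , λ _ _ a≤x a≤y → _ , A.refl , a≤x , a≤y

  ↓-idealBase : IsIdealBase (↓ a)
  ↓-idealBase = (_ , A.refl) , λ _ _ x≤a y≤a → _ , A.refl , x≤a , y≤a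

  compact′ : IsFilterBase F → IsIdealBase I → ⋀ e⟨ F ⟩ ≤δ ⋁ e⟨ I ⟩ →
             ∃[ a ] ∃[ b ] a ∈ F × b ∈ I × a A.≤ b
  compact′ (s , d) (s′ , d′) = compact _ _ s d s′ d′

  ⋀e≤e⇒∃ : IsFilterBase F → ⋀ e⟨ F ⟩ ≤δ e a → ∃[ f ] f ∈ F × f A.≤ a
  ⋀e≤e⇒∃ Fb F≤a with compact′ Fb ↓-idealBase (trans F≤a (≤⋁e A.refl))
  ... | f , b , f∈F , b≤a , f≤b = f , f∈F , A.trans f≤b b≤a

  e≤⋁e⇒∃ : IsIdealBase I → e a ≤δ ⋁ e⟨ I ⟩ → ∃[ i ] i ∈ I × a A.≤ i
  e≤⋁e⇒∃ Ib a≤I with compact′ ↑-filterBase Ib (trans (⋀e≤ A.refl) a≤I)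
  ... | b , i , a≤b , i∈I , b≤i = i , i∈I , A.trans a≤b b≤i

  -- `e` is given only as an order embedding. A closed element below `e a` and `e b` has, by
  -- compactness, base members below `a` and below `b`; directedness merges these into one member
  -- below `a ∧ b`.
  e-∧ : ∀ a b → e a ∧δ e b ≤δ e (a A.∧ b)
  e-∧ a b = closed≤ λ Fb F≤ →
    let f , f∈F , f≤a = ⋀e≤e⇒∃ Fb (trans F≤ (x∧y≤x _ _))
        g , g∈F , g≤b = ⋀e≤e⇒∃ Fb (trans F≤ (x∧y≤y _ _))
        h , h∈F , h≤f , h≤g = proj₂ Fb f g f∈F g∈F
    in trans (⋀e≤ h∈F) (e-mono (A.∧-greatest (A.trans h≤f f≤a) (A.trans h≤g g≤b)))

  e-∨ : ∀ a b → e (a A.∨ b) ≤δ e a ∨δ e b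
  e-∨ a b = open≥ λ Ib ≤I →
    let i , i∈I , a≤i = e≤⋁e⇒∃ Ib (trans (x≤x∨y _ _) ≤I)
        j , j∈I , b≤j = e≤⋁e⇒∃ Ib (trans (y≤x∨y _ _) ≤I)
        k , k∈I , i≤k , j≤k = proj₂ Ib i j i∈I j∈I
    in trans (e-mono (A.∨-least (A.trans a≤i i≤k) (A.trans b≤j j≤k))) (≤⋁e k∈I)

  -- Binary meets of closed elements and joins of open elements.

  infixr 7 _⊓_
  infixr 6 _⊔_

  -- For bases these are the filter generated by `F` and `G` together and the ideal generated by `I`
  -- and `J` together.
  _⊓_ _⊔_ : Pred A.Carrier ℓ → Pred A.Carrier ℓ → Pred A.Carrier ℓ
  (F ⊓ G) c = ∃[ f ] ∃[ g ] f ∈ F × g ∈ G × f A.∧ g A.≤ c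
  (I ⊔ J) c = ∃[ i ] ∃[ j ] i ∈ I × j ∈ J × c A.≤ i A.∨ j

  ⊓-filterBase : IsFilterBase F → IsFilterBase G → IsFilterBase (F ⊓ G)
  ⊓-filterBase ((f₀ , f₀∈) , Fd) ((g₀ , g₀∈) , Gd) =
    (_ , f₀ , g₀ , f₀∈ , g₀∈ , A.refl) ,
    λ _ _ (f , g , f∈ , g∈ , ≤c) (f′ , g′ , f′∈ , g′∈ , ≤c′) →
      let f″ , f″∈ , f″≤f , f″≤f′ = Fd f f′ f∈ f′∈
          g″ , g″∈ , g″≤g , g″≤g′ = Gd g g′ g∈ g′∈
      in _ , (f″ , g″ , f″∈ , g″∈ , A.refl)
         , A.trans (A-∧-mono f″≤f g″≤g) ≤c , A.trans (A-∧-mono f″≤f′ g″≤g′) ≤c′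

  ⊔-idealBase : IsIdealBase I → IsIdealBase J → IsIdealBase (I ⊔ J)
  ⊔-idealBase ((i₀ , i₀∈) , Id) ((j₀ , j₀∈) , Jd) =
    (_ , i₀ , j₀ , i₀∈ , j₀∈ , A.refl) ,
    λ _ _ (i , j , i∈ , j∈ , c≤) (i′ , j′ , i′∈ , j′∈ , c′≤) →
      let i″ , i″∈ , i≤i″ , i′≤i″ = Id i i′ i∈ i′∈
          j″ , j″∈ , j≤j″ , j′≤j″ = Jd j j′ j∈ j′∈
      in _ , (i″ , j″ , i″∈ , j″∈ , A.refl)
         , A.trans c≤ (A-∨-mono i≤i″ j≤j″) , A.trans c′≤ (A-∨-mono i′≤i″ j′≤j″)

  ⋀e-⊓ : IsFilterBase F → IsFilterBase G → ⋀ e⟨ F ⊓ G ⟩ ≈δ ⋀ e⟨ F ⟩ ∧δ ⋀ e⟨ G ⟩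
  ⋀e-⊓ ((f₀ , f₀∈) , _) ((g₀ , g₀∈) , _) = antisym
    (∧-greatest (≤⋀e λ f∈ → ⋀e≤ (_ , g₀ , f∈ , g₀∈ , A.x∧y≤x _ _))
                (≤⋀e λ g∈ → ⋀e≤ (f₀ , _ , f₀∈ , g∈ , A.x∧y≤y _ _)))
    (≤⋀e λ (_ , _ , f∈ , g∈ , ≤c) →
      trans (∧-monotonic (⋀e≤ f∈) (⋀e≤ g∈)) (trans (e-∧ _ _) (e-mono ≤c)))

  ⋁e-⊔ : IsIdealBase I → IsIdealBase J → ⋁ e⟨ I ⟩ ∨δ ⋁ e⟨ J ⟩ ≤δ ⋁ e⟨ I ⊔ J ⟩
  ⋁e-⊔ ((i₀ , i₀∈) , _) ((j₀ , j₀∈) , _) =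
    ∨-least (⋁e≤ λ i∈ → ≤⋁e (_ , j₀ , i∈ , j₀∈ , A.x≤x∨y _ _))
            (⋁e≤ λ j∈ → ≤⋁e (i₀ , _ , i₀∈ , j∈ , A.y≤x∨y _ _))

  compact-∧ : IsFilterBase F → IsFilterBase G → IsIdealBase I →
              ⋀ e⟨ F ⟩ ∧δ ⋀ e⟨ G ⟩ ≤δ ⋁ e⟨ I ⟩ →
              ∃[ f ] ∃[ g ] ∃[ i ] f ∈ F × g ∈ G × i ∈ I × f A.∧ g A.≤ i
  compact-∧ Fb Gb Ib ≤I
    with compact′ (⊓-filterBase Fb Gb) Ib (trans (reflexive (⋀e-⊓ Fb Gb)) ≤I)
  ... | _ , i , (f , g , f∈ , g∈ , ≤c) , i∈ , c≤i =
    f , g , i , f∈ , g∈ , i∈ , A.trans ≤c c≤i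

  compact-∨ : IsFilterBase F → IsIdealBase I → IsIdealBase J →
              ⋀ e⟨ F ⟩ ≤δ ⋁ e⟨ I ⟩ ∨δ ⋁ e⟨ J ⟩ →
              ∃[ f ] ∃[ i ] ∃[ j ] f ∈ F × i ∈ I × j ∈ J × f A.≤ i A.∨ j
  compact-∨ Fb Ib Jb F≤
    with compact′ Fb (⊔-idealBase Ib Jb) (trans F≤ (⋁e-⊔ Ib Jb))
  ... | f , _ , f∈ , (i , j , i∈ , j∈ , c≤) , f≤c =
    f , i , j , f∈ , i∈ , j∈ , A.trans f≤c c≤

  -- Shows in particular that the meet of `e a` with a closed element is closed, which lets
  -- `π-closed` apply to `e a ∧δ ◇ a`.
  e∧⋀e : IsFilterBase F → e a ∧δ ⋀ e⟨ F ⟩ ≈δ ⋀ e⟨ ↑ a ⊓ F ⟩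
  e∧⋀e Fb = Eq.trans
    (antisym (∧-monotonic (≤⋀e e-mono) refl) (∧-monotonic (⋀e≤ A.refl) refl))
    (Eq.sym (⋀e-⊓ ↑-filterBase Fb))

  -- Co-Heyting subtraction of an element of `A` from a closed element.

  module _ {_∖_} (coHeyting : Structures.IsCoHeyting A _∖_) where
    open Structures.IsCoHeyting coHeyting using (residual)

    infixl 6 _∖↑_

    _∖↑_ : Pred A.Carrier ℓ → A.Carrier → Pred A.Carrier ℓ
    (F ∖↑ a) c = ∃[ f ] f ∈ F × (f ∖ a) A.≤ c

    x≤x∖y∨y : ∀ x y → x A.≤ (x ∖ y) A.∨ y
    x≤x∖y∨y x y = proj₁ (residual x y _) A.refl

    ∖-monoˡ : ∀ {x y} z → x A.≤ y → (x ∖ z) A.≤ (y ∖ z)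
    ∖-monoˡ z x≤y = proj₂ (residual _ _ _) (A.trans x≤y (x≤x∖y∨y _ z))

    ∖↑-filterBase : IsFilterBase F → IsFilterBase (F ∖↑ a)
    ∖↑-filterBase {a = a} ((f₀ , f₀∈) , Fd) =
      (_ , f₀ , f₀∈ , A.refl) ,
      λ _ _ (f , f∈ , ≤c) (f′ , f′∈ , ≤c′) →
        let f″ , f″∈ , f″≤f , f″≤f′ = Fd f f′ f∈ f′∈
        in _ , (f″ , f″∈ , A.refl)
           , A.trans (∖-monoˡ a f″≤f) ≤c , A.trans (∖-monoˡ a f″≤f′) ≤c′

    -- Hence subtracting `e a` keeps an element closed. If `f ∖ a ≤ c`, residuation makes `e c` one
    -- of the `w` whose meet is the left side. Conversely, any such `w` is tested on the open
    -- elements above it: compactness gives `f ≤ i ∨ a`, that is, `f ∖ a ≤ i`.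
    ⋀e∖e : IsFilterBase F → ⋀ e⟨ F ⟩ ∖δ e a ≈δ ⋀ e⟨ F ∖↑ a ⟩
    ⋀e∖e Fb = antisym
      (≤⋀e λ (f , f∈ , ≤c) → ⋀-lower _
        (trans (⋀e≤ f∈)
          (trans (e-mono (A.trans (x≤x∖y∨y f _) (A-∨-mono ≤c A.refl))) (e-∨ _ _))))
      (⋀-greatest _ λ w F≤w∨a → open≥ λ Ib w≤I →
        let f , i , b , f∈ , i∈ , b≤a , f≤i∨b =
              compact-∨ Fb Ib ↓-idealBase
                (trans F≤w∨a (∨-monotonic w≤I (≤⋁e A.refl)))
        in trans
             (⋀e≤ (f , f∈ , proj₂ (residual _ _ _) (A.trans f≤i∨b (A-∨-mono A.refl b≤a))))
             (≤⋁e i∈))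

-- The operators as closed and open elements.

module Correspondence {ℓ} (A : BoundedLattice ℓ ℓ ℓ) (Aδ : CanonicalExtension A)
                      (_≺_ _C_ _D_ : Rel (BoundedLattice.Carrier A) ℓ) where
  private
    module A = BoundedLattice A
  open A using (_∧_)
  open import Relation.Binary.Lattice.Properties.MeetSemilattice
    (Lattice.meetSemilattice A.lattice) using () renaming (∧-monotonic to A-∧-mono)
  open Structures A
  open CanonicalExtension Aδ
  open CanonicalExtensionProperties Aδ
  open Operators A Aδ _≺_ _C_ _D_
  open import Relation.Binary.Lattice.Properties.MeetSemilattice
    (Lattice.meetSemilattice lattice) using (∧-monotonic)
  open import Relation.Binary.Lattice.Properties.JoinSemilattice
    (Lattice.joinSemilattice lattice) using (∨-monotonic)

  module Subordination (sub : IsSubordinationAlgebra _≺_) where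
    open IsSubordinationAlgebra sub

    ≺-filterBase : ∀ a → IsFilterBase (a ≺_)
    ≺-filterBase a =
      (A.⊤ , ≤-≺ (A.maximum a) ⊤≺⊤) ,
      λ _ _ a≺x a≺y → _ , ≺-∧ a≺x a≺y , A.x∧y≤x _ _ , A.x∧y≤y _ _

    ≺-idealBase : ∀ a → IsIdealBase (_≺ a)
    ≺-idealBase a =
      (A.⊥ , ≺-≤ ⊥≺⊥ (A.minimum a)) ,
      λ _ _ x≺a y≺a → _ , ∨-≺ x≺a y≺a , A.x≤x∨y _ _ , A.y≤x∨y _ _

    -- The relation can be read back from its operator: compactness yields `x` with `a ≺ x` and
    -- `x ≤ b`. The analogues for `▷`, `▶` and `◁` serve the same purpose.
    ◇≤e⇒≺ : ∀ {a b} → ◇ a ≤δ e b → a ≺ b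
    ◇≤e⇒≺ ◇a≤b with ⋀e≤e⇒∃ (≺-filterBase _) ◇a≤b
    ... | _ , a≺x , x≤b = ≺-≤ a≺x x≤b

  module Precontact (pre : IsPrecontactAlgebra _C_) where
    open IsPrecontactAlgebra pre

    C̸-idealBaseʳ : ∀ a → IsIdealBase (λ b → ¬ (a C b))
    C̸-idealBaseʳ a =
      (A.⊥ , ≤-C̸ ⊤C̸⊥ (A.maximum a)) ,
      λ _ _ aC̸x aC̸y → _ , C̸-∨ aC̸x aC̸y , A.x≤x∨y _ _ , A.y≤x∨y _ _

    C̸-idealBaseˡ : ∀ a → IsIdealBase (λ b → ¬ (b C a))
    C̸-idealBaseˡ a =
      (A.⊥ , C̸-≤ ⊥C̸⊤ (A.maximum a)) ,
      λ _ _ xC̸a yC̸a → _ , ∨-C̸ xC̸a yC̸a , A.x≤x∨y _ _ , A.y≤x∨y _ _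

    e≤▷⇒C̸ : ∀ {a b} → e b ≤δ ▷ a → ¬ (a C b)
    e≤▷⇒C̸ b≤▷a with e≤⋁e⇒∃ (C̸-idealBaseʳ _) b≤▷a
    ... | _ , aC̸x , b≤x = C̸-≤ aC̸x b≤x

    e≤▶⇒C̸ : ∀ {a b} → e a ≤δ ▶ b → ¬ (a C b)
    e≤▶⇒C̸ a≤▶b with e≤⋁e⇒∃ (C̸-idealBaseˡ _) a≤▶b
    ... | _ , xC̸b , a≤x = ≤-C̸ xC̸b a≤x

  module DualPrecontact (dual : IsDualPrecontactAlgebra _D_) where
    open IsDualPrecontactAlgebra dual

    D̸-filterBase : ∀ a → IsFilterBase (λ b → ¬ (a D b))
    D̸-filterBase a =
      (A.⊤ , ≤-D̸ (A.minimum a) ⊥D̸⊤) ,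
      λ _ _ aD̸x aD̸y → _ , D̸-∧ aD̸x aD̸y , A.x∧y≤x _ _ , A.x∧y≤y _ _

    ◁≤e⇒D̸ : ∀ {a b} → ◁ a ≤δ e b → ¬ (a D b)
    ◁≤e⇒D̸ ◁a≤b with ⋀e≤e⇒∃ (D̸-filterBase _) ◁a≤b
    ... | _ , aD̸x , x≤b = D̸-≤ aD̸x x≤b

  -- Correspondences for sp-algebras.

  module Sp (sp : IsSpAlgebra _≺_ _C_) where
    open IsSpAlgebra sp
    open IsSubordinationAlgebra isSubordinationAlgebra
    open IsPrecontactAlgebra isPrecontactAlgebra
    open Subordination isSubordinationAlgebra
    open Precontact isPrecontactAlgebra

    INC⇔ : INC _≺_ _C_ ⇔ (∀ a → ■ a ≤δ ▶ a)
    INC⇔ = mk⇔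
      (λ inc a → ⋁e≤ λ b≺a → ≤⋁e (inc _ a b≺a))
      (λ ■≤▶ a b a≺b → e≤▶⇒C̸ (trans (≤⋁e a≺b) (■≤▶ b)))

    CT▷⇔ : CT▷ _≺_ _C_ ⇔ (∀ a → (▷ ^π) (e a ∧δ ◇ a) ≤δ ▷ a)
    CT▷⇔ = mk⇔
      (λ ct a → trans (reflexive (▷^π≈ a)) (⋁-least _ λ _ (d , k≤d , v≈) →
        trans (reflexive v≈) (⋁e≤ λ dC̸c →
          -- Since `e a ∧δ ◇ a` is closed with base `↑ a ⊓ (a ≺_)`, any `d` above it lies above
          -- `a ∧ b` for some `b` with `a ≺ b`.
          let _ , (x , b , a≤x , a≺b , x∧b≤y) , y≤d = ⋀e≤e⇒∃ (base a)
                (trans (reflexive (Eq.sym (e∧⋀e (≺-filterBase a)))) k≤d)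
              a∧b≤d = A.trans (A-∧-mono a≤x A.refl) (A.trans x∧b≤y y≤d)
          in ≤⋁e (ct a b _ a≺b (≤-C̸ dC̸c a∧b≤d)))))
      (λ h a b c a≺b a∧bC̸c → e≤▷⇒C̸
        (trans (≤⋁e a∧bC̸c)
          -- `a ∧ b` lies above `e a ∧δ ◇ a`, so `▷ (a ∧ b)` is one of the joinands of `πᴷ`.
          (trans (⋁-upper _ (a ∧ b , trans (∧-monotonic refl (⋀e≤ a≺b)) (e-∧ a b) , Eq.refl))
            (trans (reflexive (Eq.sym (▷^π≈ a))) (h a)))))
      where
      base : ∀ a → IsFilterBase (↑ a ⊓ (a ≺_))
      base a = ⊓-filterBase ↑-filterBase (≺-filterBase a)

      ▷^π≈ : ∀ a → (▷ ^π) (e a ∧δ ◇ a) ≈δ πᴷ ▷ (e a ∧δ ◇ a)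
      ▷^π≈ a = π-closed ▷
        (_ , proj₁ (base a) , proj₂ (base a) , e∧⋀e (≺-filterBase a))

    CS2⇔ : CS2 _≺_ _C_ ⇔ (∀ a → (◇ a ⇒δ ▷ a) ≤δ ▷ a)
    CS2⇔ = mk⇔
      -- Each `w` in the join defining `⇒δ` is tested on the closed elements below it, which turns
      -- `◇ a ∧δ w ≤δ ▷ a` into an instance of compactness.
      (λ cs2 a → ⋁-least _ λ w ◇a∧w≤▷a → closed≤ λ Fb F≤w →
        let x , y , c , a≺x , y∈F , aC̸c , x∧y≤c =
              compact-∧ (≺-filterBase a) Fb (C̸-idealBaseʳ a)
                (trans (∧-monotonic refl F≤w) ◇a∧w≤▷a)
        in trans (⋀e≤ y∈F) (≤⋁e (cs2 a x y (C̸-≤ aC̸c x∧y≤c) a≺x)))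
      (λ h a x y aC̸x∧y a≺x → e≤▷⇒C̸
        (trans
          -- `e y` is itself such a `w`: `◇ a ∧δ e y` lies below `e (x ∧ y)`, hence below `▷ a`.
          (⋁-upper _
            (trans (∧-monotonic (⋀e≤ a≺x) refl) (trans (e-∧ x y) (≤⋁e aC̸x∧y))))
          (h a)))

    CT↓⇔ : ∀ {_⇨_} → IsHeyting _⇨_ →
           CT↓ _≺_ _C_ ⇔ (∀ b c → (■ b ∧δ ▶ (b ∧ c)) ≤δ (e b ⇒δ ▶ c))
    CT↓⇔ heyting = mk⇔
      (λ ct b c → closed≤ λ Fb F≤ →
        let f , a , f∈ , a≺b , f≤a =
              compact′ Fb (≺-idealBase b) (trans F≤ (x∧y≤x _ _))
            g , d , g∈ , dC̸b∧c , g≤d =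
              compact′ Fb (C̸-idealBaseˡ (b ∧ c)) (trans F≤ (x∧y≤y _ _))
            -- A single base member below both bounds inherits `h ≺ b` from one and non-contact with
            -- `b ∧ c` from the other, as `CT↓` requires.
            h , h∈ , h≤f , h≤g = proj₂ Fb f g f∈ g∈
            h∧bC̸c = ct h b c (≤-≺ (A.trans h≤f f≤a) a≺b)
                              (≤-C̸ dC̸b∧c (A.trans h≤g g≤d))
        in trans (⋀e≤ h∈) (⋁-upper _
             (trans (e-∧ b h)
               (≤⋁e (≤-C̸ h∧bC̸c (A.∧-greatest (A.x∧y≤y _ _) (A.x∧y≤x _ _)))))))
      (λ h a b c a≺b aC̸b∧c → e≤▶⇒C̸
        (trans
          (∧-greatest (e-mono (A.x∧y≤y a b))
            (trans (e-mono (A.x∧y≤x a b))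
              (trans (∧-greatest (≤⋁e a≺b) (≤⋁e aC̸b∧c)) (h b c))))
          -- Modus ponens for `⇒δ`; it rests on the distributivity of the Heyting algebra `A`.
          (proj₁ (⇒δ-largest distributive (e b) (▶ c)))))
      where
      heytingAlgebra : HeytingAlgebra ℓ ℓ ℓ
      heytingAlgebra = record { isHeytingAlgebra = heyting }

      open import Relation.Binary.Lattice.Properties.HeytingAlgebra heytingAlgebra
        using () renaming (isDistributiveLattice to distributive)

    CS1⇔ : CS1 _≺_ _C_ ⇔ (∀ a → ◇ a ≤δ (◇ a ∖δ ▷ a))
    CS1⇔ = mk⇔
      -- Order dual of the argument for `CS2`: each `w` in the meet defining `∖δ` is tested on the
      -- open elements above it.
      (λ cs1 a → ⋀-greatest _ λ w ◇a≤w∨▷a → open≥ λ Ib w≤I →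
        let z , y , x , a≺z , y∈I , aC̸x , z≤y∨x =
              compact-∨ (≺-filterBase a) Ib (C̸-idealBaseʳ a)
                (trans ◇a≤w∨▷a (∨-monotonic w≤I refl))
            z≤x∨y = A.trans z≤y∨x (A.∨-least (A.y≤x∨y x y) (A.x≤x∨y x y))
        in trans (⋀e≤ (cs1 a x y (≺-≤ a≺z z≤x∨y) aC̸x)) (≤⋁e y∈I))
      (λ h a x y a≺x∨y aC̸x → ◇≤e⇒≺
        -- `e y` is one of the `w` in the meet, because `◇ a ≤δ e x ∨δ e y` and `e x ≤δ ▷ a`.
        (trans (h a) (⋀-lower _
          (trans (⋀e≤ a≺x∨y)
            (trans (e-∨ x y)
              (∨-least (trans (≤⋁e aC̸x) (y≤x∨y _ _)) (x≤x∨y _ _)))))))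

  -- Correspondence for sdp-algebras.

  CT◁⇔ : IsSdpAlgebra _≺_ _D_ → ∀ {_∖_} → IsCoHeyting _∖_ →
         CT◁ _∖_ _≺_ _D_ ⇔ (∀ a → ◁ a ≤δ (◇ ^σ) (◁ a ∖δ e a))
  CT◁⇔ sdp {_∖_} coHeyting = mk⇔
    (λ ct a → trans
      (⋀-greatest _ λ _ (d , k≤d , v≈) → trans
        (≤⋀e λ d≺c →
          -- `◁ a ∖δ e a` is closed, so any `d` above it lies above some `b ∖ a` with `b` in the
          -- base of `◁ a`; then `d ≺ c` gives `b ∖ a ≺ c`.
          let _ , (b , aD̸b , b∖a≤x) , x≤d = ⋀e≤e⇒∃ (base a)
                (trans (reflexive (Eq.sym (◁∖≈ a))) k≤d)
          in ⋀e≤ (ct a b _ aD̸b (≤-≺ (A.trans b∖a≤x x≤d) d≺c)))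
        (reflexive (Eq.sym v≈)))
      (reflexive (Eq.sym (◇^σ≈ a))))
    (λ h a b c aD̸b b∖a≺c → ◁≤e⇒D̸
      (trans (h a)
        (trans (reflexive (◇^σ≈ a))
          (trans
            -- `b ∖ a` belongs to the base of `◁ a ∖δ e a`, so `◇ (b ∖ a)` is one of the elements
            -- whose meet is `σᴷ`.
            (⋀-lower _ (b ∖ a
              , trans (reflexive (◁∖≈ a)) (⋀e≤ (b , aD̸b , A.refl)) , Eq.refl))
            (⋀e≤ b∖a≺c)))))
    where
    open IsSdpAlgebra sdp
    open IsSubordinationAlgebra isSubordinationAlgebra
    open Subordination isSubordinationAlgebra
    open DualPrecontact isDualPrecontactAlgebra

    base : ∀ a → IsFilterBase (_∖↑_ coHeyting (λ b → ¬ (a D b)) a)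
    base a = ∖↑-filterBase coHeyting (D̸-filterBase a)

    ◁∖≈ : ∀ a → ◁ a ∖δ e a ≈δ ⋀ e⟨ _∖↑_ coHeyting (λ b → ¬ (a D b)) a ⟩
    ◁∖≈ a = ⋀e∖e coHeyting (D̸-filterBase a)

    ◇^σ≈ : ∀ a → (◇ ^σ) (◁ a ∖δ e a) ≈δ σᴷ ◇ (◁ a ∖δ e a)
    ◇^σ≈ a = σ-closed ◇ (_ , proj₁ (base a) , proj₂ (base a) , ◁∖≈ a)

proposition5p6 :
  ∀ {ℓ} (A : BoundedLattice ℓ ℓ ℓ) (Aδ : CanonicalExtension A)
    (_≺_ _C_ _D_ : Rel (BoundedLattice.Carrier A) ℓ) →
  let open BoundedLattice A using (_∧_)
      open Structures A
      open CanonicalExtension Aδ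
      open Operators A Aδ _≺_ _C_ _D_
  in
  IsSpAlgebra _≺_ _C_ →
  IsSdpAlgebra _≺_ _D_ →
    (INC _≺_ _C_ ⇔ (∀ a → ■ a ≤δ ▶ a))
  × (CT▷ _≺_ _C_ ⇔ (∀ a → (▷ ^π) (e a ∧δ ◇ a) ≤δ ▷ a))
  × (∀ _⇨_ → IsHeyting _⇨_ →
        (CS2 _≺_ _C_ ⇔ (∀ a → (◇ a ⇒δ ▷ a) ≤δ ▷ a))
      × (CT↓ _≺_ _C_ ⇔ (∀ b c → (■ b ∧δ ▶ (b ∧ c)) ≤δ (e b ⇒δ ▶ c))))
  × (∀ _∖_ → IsCoHeyting _∖_ →
        (CS1 _≺_ _C_ ⇔ (∀ a → ◇ a ≤δ (◇ a ∖δ ▷ a))))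
  × (∀ _∖_ → IsCoHeyting _∖_ →
        (CT◁ _∖_ _≺_ _D_ ⇔ (∀ a → ◁ a ≤δ (◇ ^σ) (◁ a ∖δ e a))))
proposition5p6 A Aδ _≺_ _C_ _D_ sp sdp =
    INC⇔
  , CT▷⇔
  , (λ _ heyting → CS2⇔ , CT↓⇔ heyting)
  , (λ _ _ → CS1⇔)
  , (λ _ coHeyting → CT◁⇔ sdp coHeyting)
  where
  open Correspondence A Aδ _≺_ _C_ _D_
  open Sp sp
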